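{- For every integer $n\ge 0$, $$\Delta b_{2,2}(2n+1)=\Delta b_{2,2}(2n)=b_{1,2}(n+1).$$
   Context: A partition $\lambda=(\lambda_1,\dots,\lambda_\ell)$ of $n$ is a weakly decreasing sequence of positive integers with sum $n$, identified with its multiset of parts; $\ell(\lambda)=\ell$ is its length; the empty partition is the only partition of $0$. A binary partition is a partition all of whose parts are powers of $2$ (including $2^0=1$), and $\mathcal B(n)$ is the set of binary partitions of $n$. For a partition $\lambda$ with $\ell(\lambda)\ge2$, $\mathrm{pre}_2(\lambda)$ is the partition whose multiset of parts is $\{\lambda_i\lambda_k\mid 1\le i<k\le\ell(\lambda)\}$ (with multiplicity, one part for each pair $i<k$); if $\ell(\lambda)<2$, $\mathrm{pre}_2(\lambda)=\emptyset$. $\mathrm{pre}_2(\mathcal B(n))$ is the set of partitions $\mathrm{pre}_2(\lambda)$ with $\lambda\in\mathcal B(n)$. For $i\in\{1,2\}$, $b_{i,2}(n)$ is the total number of parts equal to $i$ (counted with multiplicity) in all partitions in $\mathrm{pre}_2(\mathcal B(n))$; in particular $b_{2,2}(0)=0$. For $n\ge0$, $\Delta b_{2,2}(n)=b_{2,2}(n+1)-b_{2,2}(n)$. -}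

module Defs where

open import Data.Nat using (ℕ; zero; suc; _+_; _*_; _^_; _<_; _≥_; _>_; z<s; s≤s; _≟_; _≥?_; _>?_)
open import Data.Nat.Properties
  using (≤-decTotalOrder; anyUpTo?; ≤-trans; ≤-reflexive; +-mono-≤; +-identityʳ; m^n>0; *-mono-≤; suc-injective)
open import Data.Integer as ℤ using (ℤ)
open import Data.List using (List; []; _∷_; _++_; map; length; filter; concatMap; deduplicate)
open import Data.Nat.ListAction using (sum)
open import Data.List.Properties using (≡-dec)
open import Data.List.Membership.Propositional using (_∈_; lose)
open import Data.List.Membership.Propositional.Properties
  using (∈-concatMap⁺; ∈-filter⁺; ∈-filter⁻; ∈-map⁺; ∈-map⁻; ∈-deduplicate⁺; ∈-deduplicate⁻)
open import Data.List.Relation.Unary.All using (All; []; _∷_; all?)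
import Data.List.Relation.Unary.All as All
import Data.List.Relation.Unary.All.Properties as All
open import Data.List.Relation.Unary.Any using (here; there)
open import Data.List.Relation.Unary.Linked using (Linked; linked?)
open import Data.List.Relation.Unary.Unique.Propositional using (Unique)
import Data.List.Relation.Unary.Unique.DecPropositional.Properties as Unique
open import Data.List.Relation.Binary.Permutation.Propositional using (↭-sym)
open import Data.List.Relation.Binary.Permutation.Propositional.Properties using (All-resp-↭)
import Data.List.Sort as Sort
open import Data.Product using (∃-syntax; _×_; _,_; proj₂)
open import Function using (_⇔_; mk⇔)
open import Relation.Binary using (DecidableEquality)
import Relation.Binary.Construct.Flip.EqAndOrd as Flip
open import Relation.Binary.PropositionalEquality using (_≡_; refl; sym; cong; subst)
open import Relation.Nullary.Decidable using (map′; _×-dec_)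
open import Relation.Unary using (Decidable)

IsPartition : List ℕ → Set
IsPartition μ = Linked _≥_ μ × All (_> 0) μ

IsPowerOfTwo : ℕ → Set
IsPowerOfTwo m = ∃[ k ] m ≡ 2 ^ k

IsBinaryPartition : ℕ → List ℕ → Set
IsBinaryPartition n μ = IsPartition μ × sum μ ≡ n × All IsPowerOfTwo μ

k<2^k : ∀ k → k < 2 ^ k
k<2^k zero    = z<s
k<2^k (suc k) = ≤-trans (+-mono-≤ (m^n>0 2 k) (k<2^k k))
  (≤-reflexive (cong (2 ^ k +_) (sym (+-identityʳ (2 ^ k)))))

isPowerOfTwo? : Decidable IsPowerOfTwo
isPowerOfTwo? m = map′
  (λ (k , _ , m≡2^k) → k , m≡2^k)
  (λ (k , m≡2^k) → k , subst (k <_) (sym m≡2^k) (k<2^k k) , m≡2^k)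
  (anyUpTo? (λ k → m ≟ 2 ^ k) m)

isBinaryPartition? : ∀ n → Decidable (IsBinaryPartition n)
isBinaryPartition? n μ =
  (linked? _≥?_ μ ×-dec all? (_>? 0) μ) ×-dec (sum μ ≟ n) ×-dec all? isPowerOfTwo? μ

-- All sequences of positive integers with sum n: a composition of suc n either
-- starts with 1 or is a composition of n with its first part increased by 1.
grow : List ℕ → List (List ℕ)
grow []      = (1 ∷ []) ∷ []
grow (p ∷ c) = (1 ∷ p ∷ c) ∷ (suc p ∷ c) ∷ []

compositions : ℕ → List (List ℕ)
compositions zero    = [] ∷ []
compositions (suc n) = concatMap grow (compositions n)

ℬ : ℕ → List (List ℕ)
ℬ n = filter (isBinaryPartition? n) (compositions n)

compositions-complete : ∀ n c → All (_> 0) c → sum c ≡ n → c ∈ compositions n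
compositions-complete zero    []                _          _  = here refl
compositions-complete zero    (suc _ ∷ _)       _          ()
compositions-complete zero    (zero ∷ _)        (() ∷ _)   _
compositions-complete (suc n) []                _          ()
compositions-complete (suc n) (zero ∷ _)        (() ∷ _)   _
compositions-complete (suc n) (suc zero ∷ c)    (_ ∷ c>0) eq =
  ∈-concatMap⁺ grow (lose (compositions-complete n c c>0 (suc-injective eq)) (1∷∈grow c))
  where
  1∷∈grow : ∀ c → (1 ∷ c) ∈ grow c
  1∷∈grow []      = here refl
  1∷∈grow (_ ∷ _) = here refl
compositions-complete (suc n) (suc (suc p) ∷ c) (_ ∷ c>0) eq =
  ∈-concatMap⁺ grow
    (lose (compositions-complete n (suc p ∷ c) (z<s ∷ c>0) (suc-injective eq)) (there (here refl)))

∈ℬ⇔ : ∀ n μ → μ ∈ ℬ n ⇔ IsBinaryPartition n μ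
∈ℬ⇔ n μ = mk⇔
  (λ μ∈ → proj₂ (∈-filter⁻ (isBinaryPartition? n) {xs = compositions n} μ∈))
  (λ { bp@((_ , μ>0) , sum≡n , _) →
       ∈-filter⁺ (isBinaryPartition? n) (compositions-complete n μ μ>0 sum≡n) bp })

-- The products λᵢλₖ over all pairs of positions i < k.
pairProducts : List ℕ → List ℕ
pairProducts []      = []
pairProducts (x ∷ μ) = map (x *_) μ ++ pairProducts μ

open Sort (Flip.decTotalOrder ≤-decTotalOrder) public
  using () renaming (sort to sort≥; sort-↭ to sort≥-↭; sort-↗ to sort≥-↘)

-- For fewer than two parts there are no pairs, so this is the empty partition.
pre₂ : List ℕ → List ℕ
pre₂ μ = sort≥ (pairProducts μ)

pairProducts>0 : ∀ {μ} → All (_> 0) μ → All (_> 0) (pairProducts μ)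
pairProducts>0 []          = []
pairProducts>0 (x>0 ∷ μ>0) =
  All.++⁺ (All.map⁺ (All.map (*-mono-≤ x>0) μ>0)) (pairProducts>0 μ>0)

pre₂-isPartition : ∀ {μ} → IsPartition μ → IsPartition (pre₂ μ)
pre₂-isPartition {μ} (_ , μ>0) =
  sort≥-↘ (pairProducts μ) ,
  All-resp-↭ (↭-sym (sort≥-↭ (pairProducts μ))) (pairProducts>0 μ>0)

_≟ᴾ_ : DecidableEquality (List ℕ)
_≟ᴾ_ = ≡-dec _≟_

-- pre₂(ℬ(n)) is a set: partitions arising from several members of ℬ n, if any,
-- are listed once.
pre₂ℬ : ℕ → List (List ℕ)
pre₂ℬ n = deduplicate _≟ᴾ_ (map pre₂ (ℬ n))

∈pre₂ℬ⇔ : ∀ n ν → ν ∈ pre₂ℬ n ⇔ (∃[ μ ] IsBinaryPartition n μ × ν ≡ pre₂ μ)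
∈pre₂ℬ⇔ n ν = mk⇔ to from
  where
  open Function.Equivalence using () renaming (to to ⇒; from to ⇐)
  to : ν ∈ pre₂ℬ n → ∃[ μ ] IsBinaryPartition n μ × ν ≡ pre₂ μ
  to ν∈ with ∈-map⁻ pre₂ (∈-deduplicate⁻ _≟ᴾ_ (map pre₂ (ℬ n)) ν∈)
  ... | μ , μ∈ , ν≡ = μ , ⇒ (∈ℬ⇔ n μ) μ∈ , ν≡
  from : (∃[ μ ] IsBinaryPartition n μ × ν ≡ pre₂ μ) → ν ∈ pre₂ℬ n
  from (μ , bp , refl) = ∈-deduplicate⁺ _≟ᴾ_ (∈-map⁺ pre₂ (⇐ (∈ℬ⇔ n μ) bp))

pre₂ℬ-unique : ∀ n → Unique (pre₂ℬ n)
pre₂ℬ-unique n = Unique.deduplicate-! _≟ᴾ_ (map pre₂ (ℬ n))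

multiplicity : ℕ → List ℕ → ℕ
multiplicity i ν = length (filter (i ≟_) ν)

b₁,₂ b₂,₂ : ℕ → ℕ
b₁,₂ n = sum (map (multiplicity 1) (pre₂ℬ n))
b₂,₂ n = sum (map (multiplicity 2) (pre₂ℬ n))

Δ : (ℕ → ℕ) → ℕ → ℤ
Δ f n = ℤ.+ f (suc n) ℤ.- ℤ.+ f n

{-# OPTIONS --safe #-}

-- Injectivity of pre₂ on the partitions of n: with p_K the K-th power sum,
-- p_K(λ)² = p_2K(λ) + 2 p_K(pre₂ λ), so |λ| = p_1(λ) and pre₂ λ determine
-- p_K(λ) for K = 1, 2, 4, 8, …; as K grows these are dominated by the largest
-- part, which can therefore be read off and removed.  Hence the parts of
-- pre₂(ℬ(n)) may be counted by summing over ℬ(n).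
--
-- A binary partition either ends in 1 or is the double of a binary partition.
-- Appending a 1 to λ adds one part i to pre₂ λ for each part i of λ, and the
-- parts of pre₂ of a doubled partition are divisible by 4.  So for i = 1, 2 the
-- number b_i,₂(n + 1) − b_i,₂(n) is the number of parts i in ℬ(n), and counting
-- 2s in ℬ(2n) satisfies the same recurrence in n as b₁,₂(n + 1).
module Submission where

open import Defs
open import Data.Nat using (ℕ; _+_; _*_)
open import Data.Integer using (+_)
open import Data.Product using (_×_)
open import Relation.Binary.PropositionalEquality using (_≡_)

import Data.Integer as ℤ
import Data.Integer.Properties as ℤ
open import Data.List using (List; []; _∷_; _∷ʳ_; _++_; map; length; filter; deduplicate)
open import Data.List.Membership.Propositional using (_∈_)
open import Data.List.Membership.Propositional.Properties
  using (∈-map⁺; ∈-map⁻; ∈-++⁺ˡ; ∈-++⁺ʳ; ∈-++⁻; ∈-deduplicate⁺; ∈-deduplicate⁻)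
open import Data.List.Membership.Propositional.Properties.WithK using (unique∧set⇒bag)
open import Data.List.Properties
  using (map-∘; map-++; map-cong; map-injective; length-++; filter-++;
    filter-none; filter-accept; filter-reject; ∷ʳ-injectiveˡ)
open import Data.List.Relation.Binary.BagAndSetEquality using (∼bag⇒↭)
open import Data.List.Relation.Binary.Permutation.Propositional as ↭ using (_↭_; ↭-sym; ↭-reflexive)
open import Data.List.Relation.Binary.Permutation.Propositional.Properties
  using (↭-length; filter-↭; ∷↭∷ʳ; ++⁺; shifts) renaming (map⁺ to ↭-map⁺)
open import Data.List.Relation.Unary.All as All using (All; []; _∷_)
import Data.List.Relation.Unary.All.Properties as All
open import Data.List.Relation.Unary.AllPairs using ([]; _∷_)
open import Data.List.Relation.Unary.Any using (here; there)
open import Data.List.Relation.Unary.Linked as Linked using (Linked; []; [-]; _∷_)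
import Data.List.Relation.Unary.Linked.Properties as Linked
open import Data.List.Relation.Unary.Unique.Propositional using (Unique)
import Data.List.Relation.Unary.Unique.Propositional.Properties as Unique
import Data.List.Relation.Unary.Unique.DecPropositional.Properties as UniqueDec
open import Data.Nat using (zero; suc; _∸_; _^_; _≤_; _<_; _≥_; _>_; z≤n; s≤s; _≟_; NonZero)
open import Data.Nat.Divisibility using (_∣_; divides; _∣?_; m∣m*n)
open import Data.Nat.ListAction using (sum)
open import Data.Nat.ListAction.Properties using (sum-++; sum-↭)
open import Data.Nat.Properties
open import Data.Nat.Tactic.RingSolver using (solve-∀)
open import Data.Product using (_,_)
open import Data.Sum using (inj₁; inj₂)
open import Function using (_∘_; _⇔_; mk⇔; flip; Equivalence)
open import Relation.Binary using (tri<; tri≈; tri>)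
open import Relation.Binary.PropositionalEquality
  using (_≢_; _≗_; refl; sym; trans; cong; cong₂; subst; module ≡-Reasoning)
open import Relation.Nullary using (¬_; yes; no; contradiction)
open import Relation.Nullary.Decidable using (from-no)

open Equivalence using (to; from)

-- Sums over lists

sumOver : ∀ {a} {A : Set a} → (A → ℕ) → List A → ℕ
sumOver f xs = sum (map f xs)

module _ {a} {A : Set a} where

  sumOver-cong : {f g : A → ℕ} → f ≗ g → ∀ xs → sumOver f xs ≡ sumOver g xs
  sumOver-cong f≗g xs = cong sum (map-cong f≗g xs)

  sumOver-↭ : ∀ (f : A → ℕ) {xs ys} → xs ↭ ys → sumOver f xs ≡ sumOver f ys
  sumOver-↭ f xs↭ys = sum-↭ (↭-map⁺ f xs↭ys)

  sumOver-++ : ∀ (f : A → ℕ) xs ys → sumOver f (xs ++ ys) ≡ sumOver f xs + sumOver f ys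
  sumOver-++ f xs ys = trans (cong sum (map-++ f xs ys)) (sum-++ (map f xs) (map f ys))

  sumOver-map : ∀ {b} {B : Set b} (f : B → ℕ) (g : A → B) xs → sumOver f (map g xs) ≡ sumOver (f ∘ g) xs
  sumOver-map f g xs = cong sum (sym (map-∘ xs))

  sumOver-+ : ∀ (f g : A → ℕ) xs → sumOver (λ x → f x + g x) xs ≡ sumOver f xs + sumOver g xs
  sumOver-+ f g []       = refl
  sumOver-+ f g (x ∷ xs) rewrite sumOver-+ f g xs = lemma (f x) (g x) (sumOver f xs) (sumOver g xs)
    where
    lemma : ∀ a b c d → a + b + (c + d) ≡ a + c + (b + d)
    lemma = solve-∀

  sumOver-0 : ∀ (xs : List A) → sumOver (λ _ → 0) xs ≡ 0
  sumOver-0 []       = refl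
  sumOver-0 (x ∷ xs) = sumOver-0 xs

  -- Reduces the later identities between sums over partitions to membership equivalences.
  unique∧set⇒↭ : ∀ {xs ys : List A} → Unique xs → Unique ys →
    (∀ {x} → x ∈ xs ⇔ x ∈ ys) → xs ↭ ys
  unique∧set⇒↭ xs! ys! xs⇔ys = ∼bag⇒↭ (unique∧set⇒bag xs! ys! xs⇔ys)

  -- Injectivity is asked only on members of the list: `pre₂` is shown injective only on partitions
  -- with a common sum.
  unique-map-∈ : ∀ {b} {B : Set b} {f : A → B} {xs} →
    (∀ {x y} → x ∈ xs → y ∈ xs → f x ≡ f y → x ≡ y) → Unique xs → Unique (map f xs)
  unique-map-∈ inj []        = []
  unique-map-∈ inj (x∉ ∷ xs) =
    All.map⁺ (All.tabulate λ y∈ eq → All.lookup x∉ y∈ (inj (here refl) (there y∈) eq))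
    ∷ unique-map-∈ (λ p q → inj (there p) (there q)) xs

-- Power sums determine a partition

powerSum : ℕ → List ℕ → ℕ
powerSum K = sumOver (_^ K)

powerSum-1 : ∀ μ → powerSum 1 μ ≡ sum μ
powerSum-1 []      = refl
powerSum-1 (x ∷ μ) = cong₂ _+_ (*-identityʳ x) (powerSum-1 μ)

*-distribʳ-^ : ∀ K x y → (x * y) ^ K ≡ x ^ K * y ^ K
*-distribʳ-^ zero    x y = refl
*-distribʳ-^ (suc K) x y rewrite *-distribʳ-^ K x y = lemma x y (x ^ K) (y ^ K)
  where
  lemma : ∀ a b c d → a * b * (c * d) ≡ a * c * (b * d)
  lemma = solve-∀

powerSum-map-* : ∀ K x μ → powerSum K (map (x *_) μ) ≡ x ^ K * powerSum K μ
powerSum-map-* K x []      = sym (*-zeroʳ (x ^ K))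
powerSum-map-* K x (y ∷ μ) rewrite powerSum-map-* K x μ | *-distribʳ-^ K x y =
  sym (*-distribˡ-+ (x ^ K) (y ^ K) (powerSum K μ))

-- `_^ K` is multiplicative, so this expands the square of a sum of `K`-th powers; a head `x`
-- contributes its own square and twice its products with the tail.
powerSum-square : ∀ K μ →
  powerSum K μ * powerSum K μ ≡ powerSum (K + K) μ + 2 * powerSum K (pairProducts μ)
powerSum-square K []      = refl
powerSum-square K (x ∷ μ)
  rewrite sumOver-++ (_^ K) (map (x *_) μ) (pairProducts μ)
        | powerSum-map-* K x μ
        | ^-distribˡ-+-* x K K
  = begin
  (x ^ K + p) * (x ^ K + p)                                           ≡⟨ expand (x ^ K) p ⟩
  x ^ K * x ^ K + 2 * (x ^ K * p) + p * p                             ≡⟨ cong (λ s → x ^ K * x ^ K + 2 * (x ^ K * p) + s) (powerSum-square K μ) ⟩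
  x ^ K * x ^ K + 2 * (x ^ K * p) + (powerSum (K + K) μ + 2 * q)      ≡⟨ collect (x ^ K * x ^ K) (x ^ K * p) _ q ⟩
  x ^ K * x ^ K + powerSum (K + K) μ + 2 * (x ^ K * p + q)            ∎
  where
  open ≡-Reasoning
  p q : ℕ
  p = powerSum K μ
  q = powerSum K (pairProducts μ)
  expand : ∀ a b → (a + b) * (a + b) ≡ a * a + 2 * (a * b) + b * b
  expand = solve-∀
  collect : ∀ a b c d → a + 2 * b + (c + 2 * d) ≡ a + c + 2 * (b + d)
  collect = solve-∀

-- The square identity leads from exponent `K` to `K + K`, so starting from the sum it reaches
-- exactly the powers of two.
powerSum-2^k : ∀ μ ν → sum μ ≡ sum ν → pairProducts μ ↭ pairProducts ν →
  ∀ k → powerSum (2 ^ k) μ ≡ powerSum (2 ^ k) ν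
powerSum-2^k μ ν sums pairs zero    = trans (powerSum-1 μ) (trans sums (sym (powerSum-1 ν)))
powerSum-2^k μ ν sums pairs (suc k) rewrite +-identityʳ (2 ^ k) =
  +-cancelʳ-≡ (2 * powerSum K (pairProducts ν)) _ _ (begin
    powerSum (K + K) μ + 2 * powerSum K (pairProducts ν)  ≡⟨ cong (λ s → powerSum (K + K) μ + 2 * s) (sumOver-↭ (_^ K) pairs) ⟨
    powerSum (K + K) μ + 2 * powerSum K (pairProducts μ)  ≡⟨ powerSum-square K μ ⟨
    powerSum K μ * powerSum K μ                           ≡⟨ cong₂ _*_ ih ih ⟩
    powerSum K ν * powerSum K ν                           ≡⟨ powerSum-square K ν ⟩
    powerSum (K + K) ν + 2 * powerSum K (pairProducts ν)  ∎)
  where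
  open ≡-Reasoning
  K : ℕ
  K = 2 ^ k
  ih : powerSum K μ ≡ powerSum K ν
  ih = powerSum-2^k μ ν sums pairs k

-- Bernoulli's inequality (1 + 1/y)^K ≥ 1 + K/y, cleared of denominators.
bernoulli : ∀ y K → (y + K) * y ^ K ≤ y * suc y ^ K
bernoulli y zero    = ≤-reflexive (cong (_* 1) (+-identityʳ y))
bernoulli y (suc K) = begin
  (y + suc K) * (y * y ^ K)              ≤⟨ m≤m+n _ (K * y ^ K) ⟩
  (y + suc K) * (y * y ^ K) + K * y ^ K  ≡⟨ lemma y K (y ^ K) ⟩
  suc y * ((y + K) * y ^ K)              ≤⟨ *-monoʳ-≤ (suc y) (bernoulli y K) ⟩
  suc y * (y * suc y ^ K)                ≡⟨ swap (suc y) y (suc y ^ K) ⟩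
  y * (suc y * suc y ^ K)                ∎
  where
  open ≤-Reasoning
  lemma : ∀ y K c → (y + suc K) * (y * c) + K * c ≡ suc y * ((y + K) * c)
  lemma = solve-∀
  swap : ∀ a b c → a * (b * c) ≡ b * (a * c)
  swap = solve-∀

-- As `x` is at least `y + 1`, Bernoulli gives (x/y)^K ≥ 1 + K/y ≥ 1 + m. The chain carries an extra
-- factor `y` to avoid the division.
*-^-<-^ : ∀ m {x y K} → 0 < y → y < x → y * m ≤ K → m * y ^ K < x ^ K
*-^-<-^ m {x} {y@(suc _)} {K} 0<y y<x ym≤K = <-≤-trans
  (*-cancelˡ-< y _ _ (begin-strict
    y * (m * y ^ K)      <⟨ *-monoʳ-< y (*-monoˡ-< (y ^ K) (n<1+n m)) ⟩
    y * (suc m * y ^ K)  ≡⟨ *-assoc y (suc m) (y ^ K) ⟨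
    y * suc m * y ^ K    ≡⟨ cong (_* y ^ K) (*-suc y m) ⟩
    (y + y * m) * y ^ K  ≤⟨ *-monoˡ-≤ (y ^ K) (+-monoʳ-≤ y ym≤K) ⟩
    (y + K) * y ^ K      ≤⟨ bernoulli y K ⟩
    y * suc y ^ K        ∎))
  (^-monoˡ-≤ K y<x)
  where
  open ≤-Reasoning
  instance
    y^K≢0 : NonZero (y ^ K)
    y^K≢0 = m^n≢0 y K

powerSum-≤ : ∀ K {y} μ → All (_≤ y) μ → powerSum K μ ≤ length μ * y ^ K
powerSum-≤ K []      []          = z≤n
powerSum-≤ K (x ∷ μ) (x≤y ∷ μ≤y) = +-mono-≤ (^-monoˡ-≤ K x≤y) (powerSum-≤ K μ μ≤y)

head-bound : ∀ {y μ} → Linked _≥_ (y ∷ μ) → All (_≤ y) (y ∷ μ)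
head-bound = Linked.Linked⇒All (flip ≤-trans) ≤-refl

-- All parts of `y ∷ ν` are at most `y`, so its power sum is at most `m * y ^ K`, which the single
-- term `x ^ K` outgrows if `x` is larger.
powerSum-head-≮ : ∀ {x y μ ν} → IsPartition (y ∷ ν) →
  (∀ k → powerSum (2 ^ k) (x ∷ μ) ≡ powerSum (2 ^ k) (y ∷ ν)) → ¬ y < x
powerSum-head-≮ {x} {y} {μ} {ν} (linked , y>0 ∷ _) eq y<x = n≮n _ (begin-strict
  powerSum K (x ∷ μ)        ≡⟨ eq k ⟩
  powerSum K (y ∷ ν)        ≤⟨ powerSum-≤ K (y ∷ ν) (head-bound linked) ⟩
  m * y ^ K                 <⟨ *-^-<-^ m y>0 y<x (<⇒≤ (k<2^k k)) ⟩
  x ^ K                     ≤⟨ m≤m+n (x ^ K) _ ⟩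
  powerSum K (x ∷ μ)        ∎)
  where
  open ≤-Reasoning
  m k K : ℕ
  m = length (y ∷ ν)
  -- With this choice `k < 2 ^ k` puts the exponent `K` above the threshold `y * m` of `*-^-<-^`.
  k = y * m
  K = 2 ^ k

isPartition-tail : ∀ {x μ} → IsPartition (x ∷ μ) → IsPartition μ
isPartition-tail (linked , _ ∷ μ>0) = Linked.tail linked , μ>0

powerSum-injective : ∀ {μ ν} → IsPartition μ → IsPartition ν →
  (∀ k → powerSum (2 ^ k) μ ≡ powerSum (2 ^ k) ν) → μ ≡ ν
powerSum-injective {[]}        {[]}        pμ pν eq = refl
-- At exponent `2 ^ 0` the power sum is the plain sum, which is positive for a nonempty partition.
powerSum-injective {[]}        {suc _ ∷ _} pμ pν eq = contradiction (eq 0) λ ()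
powerSum-injective {[]}        {zero ∷ _}  pμ (_ , () ∷ _) eq
powerSum-injective {suc _ ∷ _} {[]}        pμ pν eq = contradiction (eq 0) λ ()
powerSum-injective {zero ∷ _}  {[]}        (_ , () ∷ _) pν eq
powerSum-injective {x ∷ μ}     {y ∷ ν}     pμ pν eq with <-cmp x y
... | tri< x<y _ _  = contradiction x<y (powerSum-head-≮ {μ = ν} pμ (sym ∘ eq))
... | tri> _ _ y<x  = contradiction y<x (powerSum-head-≮ {μ = μ} pν eq)
... | tri≈ _ refl _ = cong (x ∷_) (powerSum-injective (isPartition-tail pμ) (isPartition-tail pν)
  λ k → +-cancelˡ-≡ (x ^ (2 ^ k)) _ _ (eq k))

-- Sorting forgets only the order of the pair products. The sums have to agree: every one-part
-- partition has empty `pre₂`.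
pre₂-injective : ∀ {μ ν} → IsPartition μ → IsPartition ν → sum μ ≡ sum ν → pre₂ μ ≡ pre₂ ν → μ ≡ ν
pre₂-injective {μ} {ν} pμ pν sums eq = powerSum-injective pμ pν (powerSum-2^k μ ν sums
  (↭.↭-trans (↭-sym (sort≥-↭ (pairProducts μ)))
    (↭.↭-trans (↭-reflexive eq) (sort≥-↭ (pairProducts ν)))))

-- Multiplicities

multiplicity-↭ : ∀ i {μ ν} → μ ↭ ν → multiplicity i μ ≡ multiplicity i ν
multiplicity-↭ i μ↭ν = ↭-length (filter-↭ (i ≟_) μ↭ν)

multiplicity-++ : ∀ i μ ν → multiplicity i (μ ++ ν) ≡ multiplicity i μ + multiplicity i ν
multiplicity-++ i μ ν = trans (cong length (filter-++ (i ≟_) μ ν)) (length-++ (filter (i ≟_) μ))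

multiplicity-map : ∀ {i j} (f : ℕ → ℕ) → (∀ x → i ≡ f x ⇔ j ≡ x) →
  ∀ μ → multiplicity i (map f μ) ≡ multiplicity j μ
multiplicity-map         f equiv []      = refl
multiplicity-map {i} {j} f equiv (x ∷ μ) with j ≟ x
... | yes j≡x rewrite filter-accept (i ≟_) {xs = map f μ} (from (equiv x) j≡x) | filter-accept (j ≟_) {xs = μ} j≡x =
  cong suc (multiplicity-map f equiv μ)
... | no j≢x rewrite filter-reject (i ≟_) {xs = map f μ} (j≢x ∘ to (equiv x)) | filter-reject (j ≟_) {xs = μ} j≢x =
  multiplicity-map f equiv μ

multiplicity-multiples : ∀ {c i} → ¬ c ∣ i → ∀ μ → multiplicity i (map (c *_) μ) ≡ 0
multiplicity-multiples {c} {i} c∤i μ = cong length (filter-none (i ≟_)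
  (All.map⁺ (All.universal (λ x i≡cx → c∤i (subst (c ∣_) (sym i≡cx) (m∣m*n x))) μ)))

-- Each old part paired with the new 1 gives itself. The order changes because that product closes
-- the block of its head.
pairProducts-∷ʳ-1 : ∀ μ → pairProducts (μ ∷ʳ 1) ↭ μ ++ pairProducts μ
pairProducts-∷ʳ-1 []      = ↭.refl
pairProducts-∷ʳ-1 (x ∷ μ) = begin
  map (x *_) (μ ∷ʳ 1) ++ pairProducts (μ ∷ʳ 1)        ≡⟨ cong (_++ pairProducts (μ ∷ʳ 1)) (map-++ (x *_) μ (1 ∷ [])) ⟩
  (map (x *_) μ ∷ʳ (x * 1)) ++ pairProducts (μ ∷ʳ 1)  ≡⟨ cong (λ y → (map (x *_) μ ∷ʳ y) ++ pairProducts (μ ∷ʳ 1)) (*-identityʳ x) ⟩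
  (map (x *_) μ ∷ʳ x) ++ pairProducts (μ ∷ʳ 1)        ↭⟨ ++⁺ (↭-sym (∷↭∷ʳ x (map (x *_) μ))) (pairProducts-∷ʳ-1 μ) ⟩
  x ∷ map (x *_) μ ++ (μ ++ pairProducts μ)           ↭⟨ ↭.prep x (shifts (map (x *_) μ) μ) ⟩
  x ∷ μ ++ (map (x *_) μ ++ pairProducts μ)           ∎
  where open ↭.PermutationReasoning

pairProducts-map-* : ∀ c μ → pairProducts (map (c *_) μ) ≡ map (c * c *_) (pairProducts μ)
pairProducts-map-* c []      = refl
pairProducts-map-* c (x ∷ μ) = begin
  map (c * x *_) (map (c *_) μ) ++ pairProducts (map (c *_) μ)         ≡⟨ cong₂ _++_ (trans (sym (map-∘ μ)) (trans (map-cong (lemma c x) μ) (map-∘ μ))) (pairProducts-map-* c μ) ⟩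
  map (c * c *_) (map (x *_) μ) ++ map (c * c *_) (pairProducts μ)     ≡⟨ map-++ (c * c *_) (map (x *_) μ) (pairProducts μ) ⟨
  map (c * c *_) (map (x *_) μ ++ pairProducts μ)                      ∎
  where
  open ≡-Reasoning
  lemma : ∀ c x y → c * x * (c * y) ≡ c * c * (x * y)
  lemma = solve-∀

-- Binary partitions

double : List ℕ → List ℕ
double = map (2 *_)

-- With no sum fixed, the property passes to tails, as the recursion in `shape` requires; `powers>0`
-- recovers positivity.
Binary : List ℕ → Set
Binary μ = Linked _≥_ μ × All IsPowerOfTwo μ

powers>0 : ∀ {μ} → All IsPowerOfTwo μ → All (_> 0) μ
powers>0 = All.map λ { (k , refl) → m^n>0 2 k }

isBinaryPartition⇔ : ∀ {n μ} → IsBinaryPartition n μ ⇔ (Binary μ × sum μ ≡ n)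
isBinaryPartition⇔ = mk⇔
  (λ { ((linked , _) , sum≡ , powers) → (linked , powers) , sum≡ })
  (λ { ((linked , powers) , sum≡) → (linked , powers>0 powers) , sum≡ , powers })

linked-∷ʳ-1 : ∀ {μ} → Linked _≥_ μ → All (_> 0) μ → Linked _≥_ (μ ∷ʳ 1)
linked-∷ʳ-1 []             _          = [-]
linked-∷ʳ-1 [-]            (x>0 ∷ []) = x>0 ∷ [-]
linked-∷ʳ-1 (x≥y ∷ linked) (_ ∷ μ>0)  = x≥y ∷ linked-∷ʳ-1 linked μ>0

linked-∷ʳ⁻ : ∀ μ {x} → Linked _≥_ (μ ∷ʳ x) → Linked _≥_ μ
linked-∷ʳ⁻ []          _              = []
linked-∷ʳ⁻ (_ ∷ [])    _              = [-]
linked-∷ʳ⁻ (_ ∷ y ∷ μ) (x≥y ∷ linked) = x≥y ∷ linked-∷ʳ⁻ (y ∷ μ) linked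

binary-∷ʳ-1 : ∀ {μ} → Binary μ → Binary (μ ∷ʳ 1)
binary-∷ʳ-1 (linked , powers) =
  linked-∷ʳ-1 linked (powers>0 powers) , All.++⁺ powers ((0 , refl) ∷ [])

binary-double : ∀ {μ} → Binary μ → Binary (double μ)
binary-double (linked , powers) =
  Linked.map⁺ (Linked.map (*-monoʳ-≤ 2) linked) ,
  All.map⁺ (All.map (λ { (k , refl) → suc k , refl }) powers)

-- A view: matching on it turns the partition into `μ ∷ʳ 1` or `double μ` with `μ` again binary.
data Shape : List ℕ → Set where
  append-1 : ∀ {μ} → Binary μ → Shape (μ ∷ʳ 1)
  doubled  : ∀ {μ} → Binary μ → Shape (double μ)

shape : ∀ {μ} → Binary μ → Shape μ
shape {[]}    _ = doubled ([] , [])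
shape {_ ∷ _} (linked , power ∷ powers) = extend (shape (Linked.tail linked , powers)) linked power
  where
  extend : ∀ {x μ} → Shape μ → Linked _≥_ (x ∷ μ) → IsPowerOfTwo x → Shape (x ∷ μ)
  extend {x} (append-1 {μ} (_ , powers)) linked power =
    append-1 {x ∷ μ} (linked-∷ʳ⁻ (x ∷ μ) linked , power ∷ powers)
  extend (doubled {μ} (_ , powers)) linked (suc k , refl) =
    doubled {2 ^ k ∷ μ} (Linked.map (*-cancelˡ-≤ 2) (Linked.map⁻ linked) , (k , refl) ∷ powers)
  -- The empty tail counts as doubled, so the one-part partition 1 arises here.
  extend (doubled {[]} _) _ (zero , refl) = append-1 ([] , [])
  -- A head 1 cannot precede a doubled part, which is at least 2.
  extend (doubled {_ ∷ _} (_ , (j , refl) ∷ _)) (1≥2y ∷ _) (zero , refl) =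
    contradiction (≤-trans (*-monoʳ-≤ 2 (m^n>0 2 j)) 1≥2y) λ { (s≤s ()) }

sum-∷ʳ-1 : ∀ μ → sum (μ ∷ʳ 1) ≡ suc (sum μ)
sum-∷ʳ-1 μ = trans (sum-++ μ (1 ∷ [])) (+-comm (sum μ) 1)

sum-double : ∀ μ → sum (double μ) ≡ 2 * sum μ
sum-double []      = refl
sum-double (x ∷ μ) = trans (cong (λ s → 2 * x + s) (sum-double μ)) (sym (*-distribˡ-+ 2 x (sum μ)))

-- ℬ n has no repetitions anyway; deduplicating avoids having to prove it.
binaryPartitions : ℕ → List (List ℕ)
binaryPartitions n = deduplicate _≟ᴾ_ (ℬ n)

binaryPartitions-unique : ∀ n → Unique (binaryPartitions n)
binaryPartitions-unique n = UniqueDec.deduplicate-! _≟ᴾ_ (ℬ n)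

∈binaryPartitions⇔ : ∀ n {μ} → μ ∈ binaryPartitions n ⇔ (Binary μ × sum μ ≡ n)
∈binaryPartitions⇔ n {μ} = mk⇔
  (λ μ∈ → to isBinaryPartition⇔ (to (∈ℬ⇔ n μ) (∈-deduplicate⁻ _≟ᴾ_ (ℬ n) μ∈)))
  (λ bp → ∈-deduplicate⁺ _≟ᴾ_ (from (∈ℬ⇔ n μ) (from isBinaryPartition⇔ bp)))

-- The partitions whose doubles have sum `n`; being empty for odd `n`, it lets one recurrence serve
-- both parities.
halfPartitions : ℕ → List (List ℕ)
halfPartitions n with 2 ∣? n
... | yes (divides q _) = binaryPartitions q
... | no _              = []

halfPartitions-unique : ∀ n → Unique (halfPartitions n)
halfPartitions-unique n with 2 ∣? n
... | yes (divides q _) = binaryPartitions-unique q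
... | no _              = []

∈halfPartitions⇔ : ∀ n {μ} → μ ∈ halfPartitions n ⇔ (Binary μ × 2 * sum μ ≡ n)
∈halfPartitions⇔ n {μ} with 2 ∣? n
... | yes (divides q refl) = mk⇔
  (λ μ∈ → let bμ , sum≡ = to (∈binaryPartitions⇔ q) μ∈ in bμ , trans (*-comm 2 (sum μ)) (cong (_* 2) sum≡))
  (λ (bμ , 2sum≡) → from (∈binaryPartitions⇔ q) (bμ , *-cancelʳ-≡ (sum μ) q 2 (trans (*-comm (sum μ) 2) 2sum≡)))
... | no 2∤n = mk⇔ (λ ()) λ (_ , 2sum≡) → contradiction (divides (sum μ) (trans (sym 2sum≡) (*-comm 2 (sum μ)))) 2∤n

halfPartitions-even : ∀ n → halfPartitions (2 * n) ≡ binaryPartitions n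
halfPartitions-even n with 2 ∣? 2 * n
... | yes (divides q 2n≡q2) = cong binaryPartitions (*-cancelʳ-≡ q n 2 (trans (sym 2n≡q2) (*-comm 2 n)))
... | no 2∤2n               = contradiction (m∣m*n n) 2∤2n

halfPartitions-odd : ∀ n → halfPartitions (suc (2 * n)) ≡ []
halfPartitions-odd n with 2 ∣? suc (2 * n)
... | yes (divides q eq) = contradiction (sym (trans eq (*-comm q 2))) (even≢odd q n)
... | no _               = refl

-- `shape` shows that the right side covers everything. It has no repetitions: both maps are
-- injective, and a doubled partition contains no 1.
binaryPartitions-suc : ∀ n → binaryPartitions (suc n) ↭
  map (_∷ʳ 1) (binaryPartitions n) ++ map double (halfPartitions (suc n))
binaryPartitions-suc n = unique∧set⇒↭ (binaryPartitions-unique (suc n))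
  (Unique.++⁺
    (Unique.map⁺ (λ {μ} {ν} → ∷ʳ-injectiveˡ μ ν) (binaryPartitions-unique n))
    (Unique.map⁺ (map-injective (λ {x} {y} → *-cancelˡ-≡ x y 2)) (halfPartitions-unique (suc n)))
    disjoint)
  (mk⇔ forth back)
  where
  disjoint : ∀ {μ} → ¬ (μ ∈ map (_∷ʳ 1) (binaryPartitions n) × μ ∈ map double (halfPartitions (suc n)))
  disjoint (p , q) with ∈-map⁻ (_∷ʳ 1) p | ∈-map⁻ double q
  ... | μ , _ , refl | ν , _ , eq = All.lookup (subst (All (1 ≢_)) (sym eq) (All.map⁺ (All.universal 1≢2x ν))) (∈-++⁺ʳ μ (here refl)) refl
    where
    1≢2x : ∀ x → 1 ≢ 2 * x
    1≢2x x 1≡2x = from-no (2 ∣? 1) (subst (2 ∣_) (sym 1≡2x) (m∣m*n x))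

  forth : ∀ {μ} → μ ∈ binaryPartitions (suc n) →
    μ ∈ map (_∷ʳ 1) (binaryPartitions n) ++ map double (halfPartitions (suc n))
  forth μ∈ with to (∈binaryPartitions⇔ (suc n)) μ∈
  ... | bμ , sum≡ with shape bμ
  ... | append-1 {ν} bν = ∈-++⁺ˡ (∈-map⁺ (_∷ʳ 1)
    (from (∈binaryPartitions⇔ n) (bν , suc-injective (trans (sym (sum-∷ʳ-1 ν)) sum≡))))
  ... | doubled {ν} bν = ∈-++⁺ʳ (map (_∷ʳ 1) (binaryPartitions n)) (∈-map⁺ double
    (from (∈halfPartitions⇔ (suc n)) (bν , trans (sym (sum-double ν)) sum≡)))

  back : ∀ {μ} → μ ∈ map (_∷ʳ 1) (binaryPartitions n) ++ map double (halfPartitions (suc n)) →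
    μ ∈ binaryPartitions (suc n)
  back μ∈ with ∈-++⁻ (map (_∷ʳ 1) (binaryPartitions n)) μ∈
  ... | inj₁ p with ∈-map⁻ (_∷ʳ 1) p
  ...   | ν , ν∈ , refl with to (∈binaryPartitions⇔ n) ν∈
  ...     | bν , sum≡ = from (∈binaryPartitions⇔ (suc n)) (binary-∷ʳ-1 bν , trans (sum-∷ʳ-1 ν) (cong suc sum≡))
  back μ∈ | inj₂ q with ∈-map⁻ double q
  ...   | ν , ν∈ , refl with to (∈halfPartitions⇔ (suc n)) ν∈
  ...     | bν , 2sum≡ = from (∈binaryPartitions⇔ (suc n)) (binary-double bν , trans (sum-double ν) 2sum≡)

sumOver-binaryPartitions-suc : ∀ f n → sumOver f (binaryPartitions (suc n)) ≡
  sumOver (f ∘ (_∷ʳ 1)) (binaryPartitions n) + sumOver (f ∘ double) (halfPartitions (suc n))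
sumOver-binaryPartitions-suc f n = begin
  sumOver f (binaryPartitions (suc n))  ≡⟨ sumOver-↭ f (binaryPartitions-suc n) ⟩
  sumOver f (xs ++ ys)                  ≡⟨ sumOver-++ f xs ys ⟩
  sumOver f xs + sumOver f ys           ≡⟨ cong₂ _+_ (sumOver-map f (_∷ʳ 1) (binaryPartitions n)) (sumOver-map f double (halfPartitions (suc n))) ⟩
  _                                     ∎
  where
  open ≡-Reasoning
  xs ys : List (List ℕ)
  xs = map (_∷ʳ 1) (binaryPartitions n)
  ys = map double (halfPartitions (suc n))

-- Counting parts

-- `pairs 1` and `pairs 2` are `b₁,₂` and `b₂,₂` counted over the binary partitions instead of over
-- the set of their images under `pre₂`.
parts pairs : ℕ → ℕ → ℕ
parts i n = sumOver (multiplicity i) (binaryPartitions n)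
pairs i n = sumOver (multiplicity i ∘ pairProducts) (binaryPartitions n)

-- This is where injectivity of `pre₂` enters: distinct binary partitions of `n` have distinct
-- images, so passing to the set of images merges none of them.
pre₂ℬ-↭ : ∀ n → pre₂ℬ n ↭ map pre₂ (binaryPartitions n)
pre₂ℬ-↭ n = unique∧set⇒↭ (pre₂ℬ-unique n)
  (unique-map-∈ inj (binaryPartitions-unique n))
  (mk⇔ forth back)
  where
  isPartition : ∀ {μ} → Binary μ → IsPartition μ
  isPartition (linked , powers) = linked , powers>0 powers

  inj : ∀ {μ ν} → μ ∈ binaryPartitions n → ν ∈ binaryPartitions n → pre₂ μ ≡ pre₂ ν → μ ≡ ν
  inj μ∈ ν∈ with to (∈binaryPartitions⇔ n) μ∈ | to (∈binaryPartitions⇔ n) ν∈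
  ... | bμ , sumμ | bν , sumν =
    pre₂-injective (isPartition bμ) (isPartition bν) (trans sumμ (sym sumν))

  forth : ∀ {ν} → ν ∈ pre₂ℬ n → ν ∈ map pre₂ (binaryPartitions n)
  forth {ν} ν∈ with to (∈pre₂ℬ⇔ n ν) ν∈
  ... | μ , bp , refl = ∈-map⁺ pre₂ (from (∈binaryPartitions⇔ n) (to isBinaryPartition⇔ bp))

  back : ∀ {ν} → ν ∈ map pre₂ (binaryPartitions n) → ν ∈ pre₂ℬ n
  back {ν} ν∈ with ∈-map⁻ pre₂ ν∈
  ... | μ , μ∈ , refl = from (∈pre₂ℬ⇔ n ν) (μ , from isBinaryPartition⇔ (to (∈binaryPartitions⇔ n) μ∈) , refl)

sumOver-pre₂ℬ : ∀ i n → sumOver (multiplicity i) (pre₂ℬ n) ≡ pairs i n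
sumOver-pre₂ℬ i n = begin
  sumOver (multiplicity i) (pre₂ℬ n)                        ≡⟨ sumOver-↭ (multiplicity i) (pre₂ℬ-↭ n) ⟩
  sumOver (multiplicity i) (map pre₂ (binaryPartitions n))  ≡⟨ sumOver-map (multiplicity i) pre₂ (binaryPartitions n) ⟩
  sumOver (multiplicity i ∘ pre₂) (binaryPartitions n)      ≡⟨ sumOver-cong (λ μ → multiplicity-↭ i (sort≥-↭ (pairProducts μ))) (binaryPartitions n) ⟩
  pairs i n                                                 ∎
  where open ≡-Reasoning

-- Only the partitions ending in 1 contribute: pair products of a doubled partition carry the factor
-- 2 * 2.
pairs-suc : ∀ {i} → ¬ 4 ∣ i → ∀ n → pairs i (suc n) ≡ parts i n + pairs i n
pairs-suc {i} 4∤i n = begin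
  pairs i (suc n)
    ≡⟨ sumOver-binaryPartitions-suc w n ⟩
  sumOver (w ∘ (_∷ʳ 1)) (binaryPartitions n) + sumOver (w ∘ double) (halfPartitions (suc n))
    ≡⟨ cong₂ _+_ (sumOver-cong append (binaryPartitions n)) (sumOver-cong vanish (halfPartitions (suc n))) ⟩
  sumOver (λ μ → multiplicity i μ + w μ) (binaryPartitions n) + sumOver (λ _ → 0) (halfPartitions (suc n))
    ≡⟨ cong₂ _+_ (sumOver-+ (multiplicity i) w (binaryPartitions n)) (sumOver-0 (halfPartitions (suc n))) ⟩
  parts i n + pairs i n + 0
    ≡⟨ +-identityʳ _ ⟩
  parts i n + pairs i n
    ∎
  where
  open ≡-Reasoning
  w : List ℕ → ℕ
  w = multiplicity i ∘ pairProducts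

  append : ∀ μ → w (μ ∷ʳ 1) ≡ multiplicity i μ + w μ
  append μ = trans (multiplicity-↭ i (pairProducts-∷ʳ-1 μ)) (multiplicity-++ i μ (pairProducts μ))

  vanish : ∀ μ → w (double μ) ≡ 0
  vanish μ = trans (cong (multiplicity i) (pairProducts-map-* 2 μ)) (multiplicity-multiples 4∤i (pairProducts μ))

-- Counting the parts 2 in binary partitions

multiplicity-2-∷ʳ-1 : ∀ μ → multiplicity 2 (μ ∷ʳ 1) ≡ multiplicity 2 μ
multiplicity-2-∷ʳ-1 μ = trans (multiplicity-++ 2 μ (1 ∷ [])) (+-identityʳ _)

multiplicity-2-double : ∀ μ → multiplicity 2 (double μ) ≡ multiplicity 1 μ
multiplicity-2-double = multiplicity-map (2 *_) λ x → mk⇔ (*-cancelˡ-≡ 1 x 2) (cong (2 *_))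

parts-2-suc : ∀ n → parts 2 (suc n) ≡ parts 2 n + sumOver (multiplicity 1) (halfPartitions (suc n))
parts-2-suc n = trans (sumOver-binaryPartitions-suc (multiplicity 2) n)
  (cong₂ _+_ (sumOver-cong multiplicity-2-∷ʳ-1 (binaryPartitions n))
             (sumOver-cong multiplicity-2-double (halfPartitions (suc n))))

-- Every binary partition of an odd number ends in 1, and removing that 1 keeps all the 2s.
parts-2-odd : ∀ n → parts 2 (suc (2 * n)) ≡ parts 2 (2 * n)
parts-2-odd n = trans (parts-2-suc (2 * n))
  (trans (cong (λ xs → parts 2 (2 * n) + sumOver (multiplicity 1) xs) (halfPartitions-odd n)) (+-identityʳ _))

-- Raising `n` by one adds `parts 1 (suc n)` to both sides: on the left through the doubled
-- partitions of `2 * suc n`, whose 2s come from 1s, on the right through `pairs-suc`.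
parts-2-even : ∀ n → parts 2 (2 * n) ≡ pairs 1 (suc n)
-- Both sides compute to 0: the empty partition has no 2, and the only partition of 1 has no pairs.
parts-2-even zero    = refl
parts-2-even (suc n) = begin
  parts 2 (2 * suc n)                                                           ≡⟨ cong (parts 2) (*-suc 2 n) ⟩
  parts 2 (suc (suc (2 * n)))                                                   ≡⟨ parts-2-suc (suc (2 * n)) ⟩
  parts 2 (suc (2 * n)) + sumOver (multiplicity 1) (halfPartitions (2 + 2 * n)) ≡⟨ cong₂ _+_ (trans (parts-2-odd n) (parts-2-even n)) (cong (sumOver (multiplicity 1)) halves) ⟩
  pairs 1 (suc n) + parts 1 (suc n)                                             ≡⟨ +-comm (pairs 1 (suc n)) _ ⟩
  parts 1 (suc n) + pairs 1 (suc n)                                             ≡⟨ pairs-suc (from-no (4 ∣? 1)) (suc n) ⟨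
  pairs 1 (suc (suc n))                                                         ∎
  where
  open ≡-Reasoning
  halves : halfPartitions (2 + 2 * n) ≡ binaryPartitions (suc n)
  halves = trans (cong halfPartitions (sym (*-suc 2 n))) (halfPartitions-even (suc n))

Δ-b₂,₂ : ∀ n → Δ b₂,₂ n ≡ + parts 2 n
Δ-b₂,₂ n rewrite sumOver-pre₂ℬ 2 (suc n) | sumOver-pre₂ℬ 2 n | pairs-suc (from-no (4 ∣? 2)) n = begin
  + (parts 2 n + pairs 2 n) ℤ.- + pairs 2 n  ≡⟨ ℤ.m-n≡m⊖n (parts 2 n + pairs 2 n) (pairs 2 n) ⟩
  -- The difference is nonnegative, so truncated subtraction computes it.
  (parts 2 n + pairs 2 n) ℤ.⊖ pairs 2 n      ≡⟨ ℤ.⊖-≥ (m≤n+m (pairs 2 n) (parts 2 n)) ⟩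
  + (parts 2 n + pairs 2 n ∸ pairs 2 n)      ≡⟨ cong +_ (m+n∸n≡m (parts 2 n) (pairs 2 n)) ⟩
  + parts 2 n                                ∎
  where open ≡-Reasoning

theorem12 : (n : ℕ) → (Δ b₂,₂ (2 * n + 1) ≡ Δ b₂,₂ (2 * n)) × (Δ b₂,₂ (2 * n) ≡ + b₁,₂ (n + 1))
theorem12 n rewrite +-comm (2 * n) 1 | +-comm n 1 =
  trans (Δ-b₂,₂ (suc (2 * n))) (trans (cong +_ (parts-2-odd n)) (sym (Δ-b₂,₂ (2 * n)))) ,
  trans (Δ-b₂,₂ (2 * n)) (cong +_ (trans (parts-2-even n) (sym (sumOver-pre₂ℬ 1 (suc n)))))
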